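{- For every positive integer $k$ and every integer $n\geq 3k$, there exists an edge-colored complete graph $G$ on $n$ vertices with $c(G)=n+k-1$ (so that $m(G)+c(G)=\binom{n+1}{2}+k-1$) that contains exactly $k$ rainbow triangles.
   Context: Graphs are finite, simple and undirected. An edge-colored graph is a graph together with an arbitrary (not necessarily proper) assignment of a color to each edge. $m(G)$ denotes the number of edges of $G$, and $c(G)$ the number of distinct colors that actually appear on the edges of $G$. A subgraph is rainbow if all its edges have pairwise distinct colors; rainbow triangles are counted as distinct subgraphs (by their vertex sets). -}

module Defs where

open import Data.Fin using (Fin; _<_; _<?_)
open import Data.List using (List; []; _∷_; length; map; filter; deduplicate; allFin; cartesianProduct)
open import Data.List.Relation.Unary.Unique.Propositional using (Unique)
open import Data.List.Relation.Unary.Unique.DecPropositional using (unique?)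
open import Data.Nat using (ℕ; _≟_)
open import Data.Product using (_×_; _,_)
open import Level using (0ℓ)
open import Relation.Binary using (Rel; Symmetric; Decidable)
open import Relation.Binary.PropositionalEquality using (_≡_; _≢_)
open import Relation.Nullary using (¬_; Dec)
open import Relation.Nullary.Decidable using (_×-dec_)

-- `color` is defined on all ordered pairs, but its values on non-adjacent
-- pairs are junk: every notion below only consults it on edges.
record EdgeColoredGraph (n : ℕ) : Set₁ where
  field
    Adj       : Rel (Fin n) 0ℓ
    adj?      : Decidable Adj
    adj-sym   : Symmetric Adj
    adj-irr   : ∀ i → ¬ Adj i i
    color     : Fin n → Fin n → ℕ
    color-sym : ∀ {i j} → Adj i j → color i j ≡ color j i

module _ {n : ℕ} (G : EdgeColoredGraph n) where
  open EdgeColoredGraph G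

  IsComplete : Set
  IsComplete = ∀ {i j} → i ≢ j → Adj i j

  -- Each unordered edge {i , j} is represented once, by the pair with i < j.
  IsEdge : Fin n × Fin n → Set
  IsEdge (i , j) = i < j × Adj i j

  isEdge? : ∀ e → Dec (IsEdge e)
  isEdge? (i , j) = (i <? j) ×-dec adj? i j

  edges : List (Fin n × Fin n)
  edges = filter isEdge? (cartesianProduct (allFin n) (allFin n))

  edgeColor : Fin n × Fin n → ℕ
  edgeColor (i , j) = color i j

  m : ℕ
  m = length edges

  c : ℕ
  c = length (deduplicate _≟_ (map edgeColor edges))

  -- For a subgraph given by a repetition-free list of its edges.
  Rainbow : List (Fin n × Fin n) → Set
  Rainbow es = Unique (map edgeColor es)

  rainbow? : ∀ es → Dec (Rainbow es)
  rainbow? es = unique? _≟_ (map edgeColor es)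

  -- The vertex set {i , j , l} is represented once, by the triple with
  -- i < j < l.
  IsRainbowTriangle : Fin n × Fin n × Fin n → Set
  IsRainbowTriangle (i , j , l) =
    IsEdge (i , j) × IsEdge (j , l) × IsEdge (i , l) ×
    Rainbow ((i , j) ∷ (j , l) ∷ (i , l) ∷ [])

  isRainbowTriangle? : ∀ t → Dec (IsRainbowTriangle t)
  isRainbowTriangle? (i , j , l) =
    isEdge? (i , j) ×-dec isEdge? (j , l) ×-dec isEdge? (i , l) ×-dec
    rainbow? ((i , j) ∷ (j , l) ∷ (i , l) ∷ [])

  rainbowTriangles : List (Fin n × Fin n × Fin n)
  rainbowTriangles =
    filter isRainbowTriangle?
      (cartesianProduct (allFin n) (cartesianProduct (allFin n) (allFin n)))

{-# OPTIONS --safe #-}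

-- Take k disjoint triangles on the first 3k vertices, in order, followed by
-- n − 3k single vertices. A triangle has three private colors on its own edges,
-- and an edge between different blocks takes the color of the earlier block.
-- A triangle of the graph that meets at least two blocks has two edges leaving its
-- earliest block; these share a color, so only the k blocks are rainbow. Every
-- block but the last contributes one further color, which gives
-- 3k + (n − 2k) − 1 colors.
module Submission where

open import Data.Fin as Fin using (Fin; zero; suc; toℕ; fromℕ<; combine; inject≤)
open import Data.Fin.Patterns using (0F; 1F; 2F)
import Data.Fin.Properties as Fin
open import Data.List using (List; []; _∷_; _++_; length; map; allFin; upTo; cartesianProduct)
open import Data.List.Membership.Propositional using (_∈_)
open import Data.List.Membership.Propositional.Properties
open import Data.List.Membership.Propositional.Properties.WithK using (unique∧set⇒bag)
open import Data.List.Properties using (length-++; length-map; length-tabulate; length-upTo)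
open import Data.List.Relation.Binary.BagAndSetEquality using (∼bag⇒↭)
open import Data.List.Relation.Binary.Permutation.Propositional.Properties using (↭-length)
open import Data.List.Relation.Unary.All using ([]; _∷_)
open import Data.List.Relation.Unary.AllPairs using ([]; _∷_)
open import Data.List.Relation.Unary.Unique.Propositional using (Unique)
open import Data.List.Relation.Unary.Unique.Propositional.Properties
  using (map⁺; ++⁺; filter⁺; allFin⁺; upTo⁺; cartesianProduct⁺)
open import Data.List.Relation.Unary.Unique.DecPropositional.Properties using (deduplicate-!)
open import Data.Nat
  using (ℕ; zero; suc; pred; _+_; _*_; _∸_; _⊓_; _≤_; _<_; z≤n; s≤s; z<s; s<s; s<s⁻¹; _≟_)
open import Data.Nat.Combinatorics using (_C_; nC1≡n; nCk+nC[k+1]≡[n+1]C[k+1])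
open import Data.Nat.Properties
open import Data.Product as Product using (Σ-syntax; ∃-syntax; ∃₂; _×_; _,_; proj₁; proj₂)
open import Data.Product.Properties using (,-injectiveˡ; ,-injectiveʳ)
open import Data.Sum using (inj₁; inj₂)
open import Function using (_∘_; mk⇔)
open import Relation.Binary.PropositionalEquality
  using (_≡_; _≢_; refl; sym; trans; cong; cong₂; subst; subst₂; module ≡-Reasoning)
open import Relation.Nullary using (contradiction; ¬?)
open import Defs

-- Counting with repetition-free lists, and the number of increasing pairs.

-- All three counts (edges, colors, rainbow triangles) are lengths of filtered or deduplicated
-- lists. Each is found by comparison with an explicit list that has the same members.
unique-set-length : ∀ {A : Set} {xs ys : List A} → Unique xs → Unique ys →
  (∀ {x} → x ∈ xs → x ∈ ys) → (∀ {x} → x ∈ ys → x ∈ xs) → length xs ≡ length ys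
unique-set-length xs! ys! xs⊆ys ys⊆xs =
  ↭-length (∼bag⇒↭ (unique∧set⇒bag xs! ys! (mk⇔ xs⊆ys ys⊆xs)))

-- Splitting off the pairs that contain `zero` makes the length obey Pascal's rule.
increasingPairs : ∀ n → List (Fin n × Fin n)
increasingPairs zero    = []
increasingPairs (suc n) =
  map (λ j → zero , suc j) (allFin n) ++ map (Product.map suc suc) (increasingPairs n)

∈-increasingPairs⁺ : ∀ {n} {i j : Fin n} → i Fin.< j → (i , j) ∈ increasingPairs n
∈-increasingPairs⁺ {i = zero}  {suc j} _   = ∈-++⁺ˡ (∈-map⁺ _ (∈-allFin j))
∈-increasingPairs⁺ {i = suc i} {suc j} i<j =
  ∈-++⁺ʳ _ (∈-map⁺ _ (∈-increasingPairs⁺ (s<s⁻¹ i<j)))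

∈-increasingPairs⁻ : ∀ {n} {i j : Fin n} → (i , j) ∈ increasingPairs n → i Fin.< j
∈-increasingPairs⁻ {suc n} ij∈ with ∈-++⁻ (map (λ j → zero , suc j) (allFin n)) ij∈
... | inj₁ ∈ˡ with _ , _ , refl ← ∈-map⁻ _ ∈ˡ = z<s
... | inj₂ ∈ʳ with _ , ∈ , refl ← ∈-map⁻ _ ∈ʳ = s<s (∈-increasingPairs⁻ ∈)

increasingPairs-! : ∀ n → Unique (increasingPairs n)
increasingPairs-! zero    = []
increasingPairs-! (suc n) =
  ++⁺ (map⁺ (Fin.suc-injective ∘ ,-injectiveʳ) (allFin⁺ n))
      (map⁺ (λ eq → cong₂ _,_ (Fin.suc-injective (,-injectiveˡ eq))
                              (Fin.suc-injective (,-injectiveʳ eq)))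
            (increasingPairs-! n))
      disjoint
  where
  disjoint : ∀ {e} → e ∈ map (λ j → zero , suc j) (allFin n) ×
                     e ∈ map (Product.map suc suc) (increasingPairs n) → _
  disjoint (∈ˡ , ∈ʳ) with _ , _ , refl ← ∈-map⁻ _ ∈ˡ with () ← proj₂ (proj₂ (∈-map⁻ _ ∈ʳ))

length-increasingPairs : ∀ n → length (increasingPairs n) ≡ n C 2
length-increasingPairs zero    = refl
length-increasingPairs (suc n) = begin
  length (increasingPairs (suc n))
    ≡⟨ length-++ (map (λ j → zero , suc j) (allFin n)) ⟩
  length (map {B = Fin (suc n) × Fin (suc n)} (λ j → zero , suc j) (allFin n)) +
  length (map (Product.map suc suc) (increasingPairs n))
    ≡⟨ cong₂ _+_ (trans (length-map _ (allFin n)) (length-tabulate _))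
                 (trans (length-map _ (increasingPairs n)) (length-increasingPairs n)) ⟩
  n + n C 2
    ≡⟨ cong (_+ n C 2) (nC1≡n n) ⟨
  n C 1 + n C 2
    ≡⟨ nCk+nC[k+1]≡[n+1]C[k+1] n 1 ⟩
  suc n C 2 ∎
  where open ≡-Reasoning

-- The block coloring on natural numbers and its range of colors.

pattern 3+ a = suc (suc (suc a))

-- The edges {0,1}, {0,2}, {1,2} of the first block get the colors 0, 1, 2, since
-- pred (a + b) enumerates them in this order; values at a = b are junk.
blockColor : ℕ → ℕ → ℕ → ℕ
blockColor zero    a      b      = a ⊓ b
blockColor (suc k) (3+ a) (3+ b) = 4 + blockColor k a b
blockColor (suc k) (3+ a) b      = 3
blockColor (suc k) a      (3+ b) = 3
blockColor (suc k) a      b      = pred (a + b)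

blockColor-sym : ∀ k a b → blockColor k a b ≡ blockColor k b a
blockColor-sym zero    a      b      = ⊓-comm a b
blockColor-sym (suc k) (3+ a) (3+ b) = cong (4 +_) (blockColor-sym k a b)
-- The later clauses of `blockColor` compute only once both arguments are known to be 0, 1, 2 or at
-- least 3, hence the enumeration.
blockColor-sym (suc k) (3+ a) 0      = refl
blockColor-sym (suc k) (3+ a) 1      = refl
blockColor-sym (suc k) (3+ a) 2      = refl
blockColor-sym (suc k) 0      (3+ b) = refl
blockColor-sym (suc k) 1      (3+ b) = refl
blockColor-sym (suc k) 2      (3+ b) = refl
blockColor-sym (suc k) 0      0      = refl
blockColor-sym (suc k) 0      1      = refl
blockColor-sym (suc k) 0      2      = refl
blockColor-sym (suc k) 1      0      = refl
blockColor-sym (suc k) 1      1      = refl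
blockColor-sym (suc k) 1      2      = refl
blockColor-sym (suc k) 2      0      = refl
blockColor-sym (suc k) 2      1      = refl
blockColor-sym (suc k) 2      2      = refl

-- Removing the first block lowers `n` by 3 and `k` by 1, so `n + k` drops by 4, the number of
-- colors that this block sets aside. Writing `suc` on the left keeps truncated subtraction out of
-- the induction.
blockColor-bound : ∀ k {n a b} → k * 3 ≤ n → a < b → b < n →
                   suc (blockColor k a b) < n + k
blockColor-bound zero {n} {a} {b} _ a<b b<n = begin-strict
  suc (a ⊓ b)  ≡⟨ cong suc (m≤n⇒m⊓n≡m (<⇒≤ a<b)) ⟩
  suc a        ≤⟨ a<b ⟩
  b            <⟨ b<n ⟩
  n            ≡⟨ +-identityʳ n ⟨
  n + 0        ∎
  where open ≤-Reasoning
blockColor-bound (suc k) {3+ n} {a} {b} (s≤s (s≤s (s≤s 3k≤n))) a<b (s≤s b<n) =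
  subst (suc (blockColor (suc k) a b) <_) (cong (3 +_) (sym (+-suc n k))) (bound a b a<b b<n)
  where
  -- Color 3 appears only if some vertex lies beyond the first block; then the number `n` of
  -- remaining vertices is positive.
  cross : ∀ {b} → 3 + b ≤ suc (suc n) → 4 < 4 + (n + k)
  cross (s≤s (s≤s b<n)) = +-monoʳ-< 4 (≤-trans (≤-trans z<s b<n) (m≤m+n n k))

  bound : ∀ a b → a < b → b ≤ suc (suc n) → suc (blockColor (suc k) a b) < 4 + (n + k)
  bound 0      1      _ _ = s<s z<s
  bound 0      2      _ _ = s<s (s<s z<s)
  bound 1      2      _ _ = s<s (s<s (s<s z<s))
  bound 1      1      (s≤s ()) _
  bound 2      1      (s≤s ()) _
  bound 2      2      (s≤s (s≤s ())) _
  bound (3+ a) 1      (s≤s ()) _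
  bound (3+ a) 2      (s≤s (s≤s ())) _
  bound 0      (3+ b) _ b<n = cross b<n
  bound 1      (3+ b) _ b<n = cross b<n
  bound 2      (3+ b) _ b<n = cross b<n
  bound (3+ a) (3+ b) (s≤s (s≤s (s≤s a<b))) (s≤s (s≤s b<n)) =
    s<s (s<s (s<s (s<s (blockColor-bound k 3k≤n a<b b<n))))

-- Colors 0, 1, 2 come from the first block, 3 from an edge leaving it, and larger ones from the
-- remaining blocks. Among single vertices, color `v` is found on the edge from `v` to its
-- successor.
blockColor-onto : ∀ k {n v} → k * 3 ≤ n → suc v < n + k →
                  ∃₂ λ a b → a < b × b < n × blockColor k a b ≡ v
blockColor-onto zero {n} {v} _ v<n =
  v , suc v , n<1+n v , subst (suc v <_) (+-identityʳ n) v<n , m≤n⇒m⊓n≡m (n≤1+n v)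
blockColor-onto (suc k) {v = 0} (s≤s (s≤s (s≤s _))) _ = 0 , 1 , z<s , s<s z<s , refl
blockColor-onto (suc k) {v = 1} (s≤s (s≤s (s≤s _))) _ = 0 , 2 , z<s , s<s (s<s z<s) , refl
blockColor-onto (suc k) {v = 2} (s≤s (s≤s (s≤s _))) _ = 1 , 2 , s<s z<s , s<s (s<s z<s) , refl
blockColor-onto (suc k) {v = 3} 3+3k≤n v<n+k = 0 , 3 , z<s , later k 3+3k≤n v<n+k , refl
  where
  -- The edge {0,3} needs a fourth vertex. It exists by the bound on the color if no second triangle
  -- follows, and lies in the second triangle otherwise.
  later : ∀ k {n} → suc k * 3 ≤ n → 4 < n + suc k → 3 < n
  later zero    {n} _ 4<n+1 = s<s⁻¹ (subst (4 <_) (+-comm n 1) 4<n+1)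
  later (suc k) 6+3k≤n _    = ≤-trans (s≤s (s≤s (s≤s (s≤s z≤n)))) 6+3k≤n
blockColor-onto (suc k) {3+ n} {suc (3+ v)} (s≤s (s≤s (s≤s 3k≤n))) v<n+k
  with a , b , a<b , b<n , refl ← blockColor-onto k {v = v} 3k≤n
         (s<s⁻¹ (s<s⁻¹ (s<s⁻¹ (s<s⁻¹ (subst (4 + suc v <_) (cong (3 +_) (+-suc n k)) v<n+k)))))
  = 3 + a , 3 + b , s<s (s<s (s<s a<b)) , s<s (s<s (s<s b<n)) , refl

-- Rainbow triangles of the block coloring.

triangleColors : ℕ → ℕ → ℕ → ℕ → List ℕ
triangleColors k a b c = blockColor k a b ∷ blockColor k b c ∷ blockColor k a c ∷ []

-- This is 3q + r, vertex `r` of block `q`. With `combine` into `Fin (k * 3)`, passing to `suc q`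
-- adds 3 definitionally, in step with the recursion of `blockColor`.
corner : ∀ {k} → Fin k → Fin 3 → ℕ
corner q r = toℕ (combine q r)

corner-mono-< : ∀ {k} (q : Fin k) {r s} → r Fin.< s → corner q r < corner q s
corner-mono-< q {r} {s} r<s rewrite Fin.toℕ-combine q r | Fin.toℕ-combine q s =
  +-monoʳ-< (3 * toℕ q) r<s

corner-rainbow : ∀ {k} (q : Fin k) →
  Unique (triangleColors k (corner q 0F) (corner q 1F) (corner q 2F))
corner-rainbow zero    = ((λ ()) ∷ (λ ()) ∷ []) ∷ ((λ ()) ∷ []) ∷ [] ∷ []
-- Shifting by one block adds 4 to each of the three colors, which keeps them distinct.
corner-rainbow (suc q) = map⁺ (+-cancelˡ-≡ 4 _ _) (corner-rainbow q)

rainbow⇒corner : ∀ k {a b c} → a < b → b < c → Unique (triangleColors k a b c) →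
  ∃[ q ] a ≡ corner {k} q 0F × b ≡ corner q 1F × c ≡ corner q 2F
-- Among single vertices, both edges at the least vertex `a` have color `a`.
rainbow⇒corner zero a<b b<c ((_ ∷ ab≢ac ∷ []) ∷ _) =
  contradiction (trans (m≤n⇒m⊓n≡m (<⇒≤ a<b)) (sym (m≤n⇒m⊓n≡m (<⇒≤ (<-trans a<b b<c))))) ab≢ac
rainbow⇒corner (suc k) {_}           {suc b}       {1} _              (s≤s ())       _
rainbow⇒corner (suc k) {_}           {suc (suc b)} {2} _              (s≤s (s≤s ())) _
rainbow⇒corner (suc k) {suc a}       {1}           {_} (s≤s ())       _              _
rainbow⇒corner (suc k) {suc (suc a)} {2}           {_} (s≤s (s≤s ())) _              _
rainbow⇒corner (suc k) {0} {1} {2} _ _ _ = zero , refl , refl , refl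
-- Two vertices in the first block: both edges to the third vertex leave the block and have color 3.
rainbow⇒corner (suc k) {0} {1} {3+ c} _ _ (_ ∷ (bc≢ac ∷ []) ∷ _) = contradiction refl bc≢ac
rainbow⇒corner (suc k) {0} {2} {3+ c} _ _ (_ ∷ (bc≢ac ∷ []) ∷ _) = contradiction refl bc≢ac
rainbow⇒corner (suc k) {1} {2} {3+ c} _ _ (_ ∷ (bc≢ac ∷ []) ∷ _) = contradiction refl bc≢ac
-- One vertex in the first block: both of its edges leave the block and have color 3.
rainbow⇒corner (suc k) {0} {3+ b} {3+ c} _ _ ((_ ∷ ab≢ac ∷ []) ∷ _) = contradiction refl ab≢ac
rainbow⇒corner (suc k) {1} {3+ b} {3+ c} _ _ ((_ ∷ ab≢ac ∷ []) ∷ _) = contradiction refl ab≢ac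
rainbow⇒corner (suc k) {2} {3+ b} {3+ c} _ _ ((_ ∷ ab≢ac ∷ []) ∷ _) = contradiction refl ab≢ac
rainbow⇒corner (suc k) {3+ a} {3+ b} {3+ c} (s≤s (s≤s (s≤s a<b))) (s≤s (s≤s (s≤s b<c)))
  ((ab≢bc ∷ ab≢ac ∷ []) ∷ (bc≢ac ∷ []) ∷ [] ∷ [])
  with q , refl , refl , refl ← rainbow⇒corner k a<b b<c
         ((ab≢bc ∘ cong (4 +_) ∷ ab≢ac ∘ cong (4 +_) ∷ []) ∷
          (bc≢ac ∘ cong (4 +_) ∷ []) ∷ [] ∷ [])
  = suc q , refl , refl , refl

-- The colored complete graph, and edge lists of graphs in general.

blockColoring : ℕ → ∀ n → EdgeColoredGraph n
blockColoring k n = record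
  { Adj       = _≢_
  ; adj?      = λ i j → ¬? (i Fin.≟ j)
  ; adj-sym   = λ i≢j → i≢j ∘ sym
  ; adj-irr   = λ _ i≢i → i≢i refl
  ; color     = λ i j → blockColor k (toℕ i) (toℕ j)
  ; color-sym = λ {i} {j} _ → blockColor-sym k (toℕ i) (toℕ j)
  }

module _ {n} (G : EdgeColoredGraph n) where

  edges-! : Unique (edges G)
  edges-! = filter⁺ (isEdge? G) (cartesianProduct⁺ (allFin⁺ n) (allFin⁺ n))

  ∈-edges⁺ : ∀ {i j} → IsEdge G (i , j) → (i , j) ∈ edges G
  ∈-edges⁺ {i} {j} = ∈-filter⁺ (isEdge? G) (∈-cartesianProduct⁺ (∈-allFin i) (∈-allFin j))

  ∈-edges⁻ : ∀ {e} → e ∈ edges G → IsEdge G e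
  ∈-edges⁻ = proj₂ ∘ ∈-filter⁻ (isEdge? G) {xs = cartesianProduct (allFin n) (allFin n)}

  complete-m : IsComplete G → m G ≡ n C 2
  complete-m complete = trans
    (unique-set-length edges-! (increasingPairs-! n)
      (∈-increasingPairs⁺ ∘ proj₁ ∘ ∈-edges⁻)
      (λ e∈ → let i<j = ∈-increasingPairs⁻ e∈ in ∈-edges⁺ (i<j , complete (Fin.<⇒≢ i<j))))
    (length-increasingPairs n)

-- Counting the colors and the rainbow triangles of the graph.

module _ (k n : ℕ) (3k≤n : k * 3 ≤ n) where

  private
    G : EdgeColoredGraph n
    G = blockColoring k n

  blockColoring-c : c G ≡ n + k ∸ 1
  blockColoring-c = trans
    (unique-set-length (deduplicate-! _≟_ _) (upTo⁺ (n + k ∸ 1)) bounded onto)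
    (length-upTo (n + k ∸ 1))
    where
    bounded : ∀ {v} → v ∈ _ → v ∈ upTo (n + k ∸ 1)
    bounded v∈ with (_ , j) , e∈ , refl ← ∈-map⁻ (edgeColor G) (∈-deduplicate⁻ _≟_ _ v∈) =
      ∈-upTo⁺ (pred-mono-< (blockColor-bound k 3k≤n (proj₁ (∈-edges⁻ G e∈)) (Fin.toℕ<n j)))

    onto : ∀ {v} → v ∈ upTo (n + k ∸ 1) → v ∈ _
    onto v∈ with a , b , a<b , b<n , refl ← blockColor-onto k 3k≤n (pred-cancel-< (∈-upTo⁻ v∈)) =
      ∈-deduplicate⁺ _≟_ (subst (_∈ _) color≡ (∈-map⁺ (edgeColor G) (∈-edges⁺ G (i<j , Fin.<⇒≢ i<j))))
      where
      a<n : a < n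
      a<n = <-trans a<b b<n

      i<j : fromℕ< a<n Fin.< fromℕ< b<n
      i<j = subst₂ _<_ (sym (Fin.toℕ-fromℕ< a<n)) (sym (Fin.toℕ-fromℕ< b<n)) a<b

      color≡ : edgeColor G (fromℕ< a<n , fromℕ< b<n) ≡ blockColor k a b
      color≡ = cong₂ (blockColor k) (Fin.toℕ-fromℕ< a<n) (Fin.toℕ-fromℕ< b<n)

  vertex : Fin k → Fin 3 → Fin n
  vertex q r = inject≤ (combine q r) 3k≤n

  toℕ-vertex : ∀ q r → toℕ (vertex q r) ≡ corner q r
  toℕ-vertex q r = Fin.toℕ-inject≤ (combine q r) 3k≤n

  blockTriangle : Fin k → Fin n × Fin n × Fin n
  blockTriangle q = vertex q 0F , vertex q 1F , vertex q 2F

  -- The first vertex of a block already determines the block.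
  blockTriangle-injective : ∀ {p q} → blockTriangle p ≡ blockTriangle q → p ≡ q
  blockTriangle-injective {p} {q} eq =
    Fin.combine-injectiveˡ p 0F q 0F (Fin.inject≤-injective _ _ _ _ (,-injectiveˡ eq))

  blockTriangle-rainbow : ∀ q → IsRainbowTriangle G (blockTriangle q)
  blockTriangle-rainbow q = edge z<s , edge (s<s z<s) , edge z<s , rainbow
    where
    edge : ∀ {r s} → r Fin.< s → IsEdge G (vertex q r , vertex q s)
    edge {r} {s} r<s = v<w , Fin.<⇒≢ v<w
      where
      v<w : vertex q r Fin.< vertex q s
      v<w rewrite toℕ-vertex q r | toℕ-vertex q s = corner-mono-< q r<s

    rainbow : Unique (triangleColors k (toℕ (vertex q 0F)) (toℕ (vertex q 1F)) (toℕ (vertex q 2F)))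
    rainbow rewrite toℕ-vertex q 0F | toℕ-vertex q 1F | toℕ-vertex q 2F = corner-rainbow q

  rainbow⇒blockTriangle : ∀ {t} → IsRainbowTriangle G t → ∃[ q ] t ≡ blockTriangle q
  rainbow⇒blockTriangle ((i<j , _) , (j<l , _) , _ , rainbow)
    with q , i≡ , j≡ , l≡ ← rainbow⇒corner k i<j j<l rainbow
    = q , cong₂ _,_ (≡vertex i≡) (cong₂ _,_ (≡vertex j≡) (≡vertex l≡))
    where
    ≡vertex : ∀ {i q r} → toℕ i ≡ corner q r → i ≡ vertex q r
    ≡vertex i≡ = Fin.toℕ-injective (trans i≡ (sym (toℕ-vertex _ _)))

  blockColoring-rainbowTriangles : length (rainbowTriangles G) ≡ k
  blockColoring-rainbowTriangles = begin
    length (rainbowTriangles G)           ≡⟨ unique-set-length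
                                               (filter⁺ (isRainbowTriangle? G) triples-!)
                                               (map⁺ blockTriangle-injective (allFin⁺ k))
                                               to from ⟩
    length (map blockTriangle (allFin k)) ≡⟨ length-map blockTriangle (allFin k) ⟩
    length (allFin k)                     ≡⟨ length-tabulate _ ⟩
    k                                     ∎
    where
    open ≡-Reasoning

    triples : List (Fin n × Fin n × Fin n)
    triples = cartesianProduct (allFin n) (cartesianProduct (allFin n) (allFin n))

    triples-! : Unique triples
    triples-! = cartesianProduct⁺ (allFin⁺ n) (cartesianProduct⁺ (allFin⁺ n) (allFin⁺ n))

    to : ∀ {t} → t ∈ rainbowTriangles G → t ∈ map blockTriangle (allFin k)
    to t∈ with q , refl ← rainbow⇒blockTriangle
                            (proj₂ (∈-filter⁻ (isRainbowTriangle? G) {xs = triples} t∈)) =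
      ∈-map⁺ blockTriangle (∈-allFin q)

    from : ∀ {t} → t ∈ map blockTriangle (allFin k) → t ∈ rainbowTriangles G
    from t∈ with q , _ , refl ← ∈-map⁻ blockTriangle t∈ =
      ∈-filter⁺ (isRainbowTriangle? G)
        (∈-cartesianProduct⁺ (∈-allFin _) (∈-cartesianProduct⁺ (∈-allFin _) (∈-allFin _)))
        (blockTriangle-rainbow q)

-- Arithmetic of the edge and color counts, and the conclusion.

-- Since `k` is positive, so is `n + k`, and the truncated subtraction can be moved outside the sum;
-- Pascal's rule then absorbs `n` into the binomial coefficient.
nC2+[n+k∸1] : ∀ n k → 1 ≤ k → n C 2 + (n + k ∸ 1) ≡ ((n + 1) C 2) + k ∸ 1
nC2+[n+k∸1] n k 1≤k = begin
  n C 2 + (n + k ∸ 1)    ≡⟨ +-∸-assoc (n C 2) (≤-trans 1≤k (m≤n+m k n)) ⟨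
  n C 2 + (n + k) ∸ 1    ≡⟨ cong (_∸ 1) (+-assoc (n C 2) n k) ⟨
  n C 2 + n + k ∸ 1      ≡⟨ cong (λ x → x + k ∸ 1) (+-comm (n C 2) n) ⟩
  n + n C 2 + k ∸ 1      ≡⟨ cong (λ x → x + n C 2 + k ∸ 1) (nC1≡n n) ⟨
  n C 1 + n C 2 + k ∸ 1  ≡⟨ cong (λ x → x + k ∸ 1) (nCk+nC[k+1]≡[n+1]C[k+1] n 1) ⟩
  (suc n C 2) + k ∸ 1    ≡⟨ cong (λ x → (x C 2) + k ∸ 1) (+-comm 1 n) ⟩
  ((n + 1) C 2) + k ∸ 1  ∎
  where open ≡-Reasoning

mainTheorem5 : ∀ (k n : ℕ) → 1 ≤ k → 3 * k ≤ n →
    Σ[ G ∈ EdgeColoredGraph n ]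
    ( IsComplete G
    × c G ≡ n + k ∸ 1
    × m G + c G ≡ ((n + 1) C 2) + k ∸ 1
    × length (rainbowTriangles G) ≡ k )
mainTheorem5 k n 1≤k 3*k≤n =
  blockColoring k n , (λ i≢j → i≢j) , c≡ ,
  trans (cong₂ _+_ (complete-m (blockColoring k n) (λ i≢j → i≢j)) c≡) (nC2+[n+k∸1] n k 1≤k) ,
  blockColoring-rainbowTriangles k n k*3≤n
  where
  k*3≤n : k * 3 ≤ n
  k*3≤n = subst (_≤ n) (*-comm 3 k) 3*k≤n

  c≡ : c (blockColoring k n) ≡ n + k ∸ 1
  c≡ = blockColoring-c k n k*3≤n
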